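{- Let $f,g:\mathbb{N}\to\mathbb{R}$ be functions with $g(n)\neq 0$ for all sufficiently large $n$, and let $K$ be a real number with $0<K<\infty$. If $f\in a(K,g)$, then $f\in O(g)$. The converse fails: there exist functions $f,g:\mathbb{N}\to\mathbb{R}$, with $g(n)\neq 0$ for all sufficiently large $n$, such that $f\in O(g)$ but $f\notin a(K,g)$ for every real $K$ with $0<K<\infty$.
   Context: Definition ("Almost"): for functions $f,g$ of $n\in\mathbb{N}$, with $g(n)\neq 0$ for all sufficiently large $n$, and a real number $K$ with $0<K<\infty$, one writes $f\in a(K,g)$ if and only if the limit $\lim_{n\to\infty} \frac{f(n)}{g(n)}$ exists and equals $K$. Definition (Big-Oh): $f\in O(g)$ if and only if $\exists k>0\ \exists n_0\ \forall n>n_0:\ |f(n)|\leq |g(n)\cdot k|$. -}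

module Defs where

open import Data.Nat.Base as ℕ using (ℕ)
import Data.Nat.Properties as ℕ
open import Data.Product.Base using (_×_; _,_; ∃-syntax)
open import Data.Rational.Base as ℚ using (ℚ; 0ℚ; 1ℚ; ½)
import Data.Rational.Properties as ℚ
open import Data.Rational.Solver using (module +-*-Solver)
open import Data.Sum.Base using (_⊎_; inj₁; inj₂)
open import Level using (0ℓ)
open import Relation.Binary.Core using (Rel)
open import Relation.Binary.PropositionalEquality
  using (_≡_; _≢_; refl; sym; trans; cong; cong₂; subst; subst₂)
open import Relation.Nullary.Decidable.Core using (yes; no)
open import Relation.Nullary.Negation.Core using (¬_; contradiction)
open import Relation.Unary using (Pred)

-- Real numbers, as Cauchy sequences of rationals with a modulus.
-- Different sequences may denote the same real number: equality of reals
-- is _≈_, not _≡_.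

record ℝ : Set where
  constructor mkℝ
  field
    seq    : ℕ → ℚ
    cauchy : ∀ ε → 0ℚ ℚ.< ε →
             ∃[ N ] (∀ m n → N ℕ.≤ m → N ℕ.≤ n → ℚ.∣ seq m ℚ.- seq n ∣ ℚ.< ε)

open ℝ public

infix 4 _≈_ _<_ _≤_ _#_

_≈_ : Rel ℝ 0ℓ
x ≈ y = ∀ ε → 0ℚ ℚ.< ε →
        ∃[ N ] (∀ n → N ℕ.≤ n → ℚ.∣ seq x n ℚ.- seq y n ∣ ℚ.< ε)

-- The uniform gap δ is needed: eventual termwise strict inequality is
-- not invariant under _≈_.

_<_ : Rel ℝ 0ℓ
x < y = ∃[ δ ] ((0ℚ ℚ.< δ) × (∃[ N ] (∀ n → N ℕ.≤ n → seq x n ℚ.+ δ ℚ.≤ seq y n)))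

_≤_ : Rel ℝ 0ℓ
x ≤ y = ¬ (y < x)

-- Apartness, the constructive form of x ≠ y (classically equivalent to
-- ¬ x ≈ y): division needs an explicit positive distance from zero.

_#_ : Rel ℝ 0ℓ
x # y = (x < y) ⊎ (y < x)

*-pos : ∀ {p q} → 0ℚ ℚ.< p → 0ℚ ℚ.< q → 0ℚ ℚ.< p ℚ.* q
*-pos {p} {q} 0<p 0<q =
  ℚ.positive⁻¹ (p ℚ.* q)
    {{ℚ.pos*pos⇒pos p {{ℚ.positive 0<p}} q {{ℚ.positive 0<q}}}}

+-pos : ∀ {p q} → 0ℚ ℚ.< p → 0ℚ ℚ.< q → 0ℚ ℚ.< p ℚ.+ q
+-pos {p} {q} 0<p 0<q = ℚ.<-trans 0<p
  (subst (ℚ._< p ℚ.+ q) (ℚ.+-identityʳ p) (ℚ.+-monoʳ-< p 0<q))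

½-pos : ∀ {p} → 0ℚ ℚ.< p → 0ℚ ℚ.< p ℚ.* ½
½-pos 0<p = *-pos 0<p (ℚ.positive⁻¹ ½)

½+½ : ∀ p → p ℚ.* ½ ℚ.+ p ℚ.* ½ ≡ p
½+½ = solve 1 (λ p → p :* con ½ :+ p :* con ½ := p) refl
  where open +-*-Solver

pos⇒≢0 : ∀ {p} → 0ℚ ℚ.< p → p ≢ 0ℚ
pos⇒≢0 0<p p≡0 = ℚ.<⇒≢ 0<p (sym p≡0)

-‿triangle : ∀ p q r s →
  ℚ.∣ (p ℚ.- q) ℚ.- (r ℚ.- s) ∣ ℚ.≤ ℚ.∣ p ℚ.- r ∣ ℚ.+ ℚ.∣ q ℚ.- s ∣
-‿triangle p q r s =
  subst (λ t → ℚ.∣ t ∣ ℚ.≤ ℚ.∣ p ℚ.- r ∣ ℚ.+ ℚ.∣ q ℚ.- s ∣)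
    (solve 4 (λ p q r s → (p :- r) :- (q :- s) := (p :- q) :- (r :- s)) refl p q r s)
    (ℚ.∣p-q∣≤∣p∣+∣q∣ (p ℚ.- r) (q ℚ.- s))
  where open +-*-Solver

*-triangle : ∀ p q r s →
  ℚ.∣ p ℚ.* q ℚ.- r ℚ.* s ∣ ℚ.≤ ℚ.∣ p ∣ ℚ.* ℚ.∣ q ℚ.- s ∣ ℚ.+ ℚ.∣ s ∣ ℚ.* ℚ.∣ p ℚ.- r ∣
*-triangle p q r s = begin
  ℚ.∣ p ℚ.* q ℚ.- r ℚ.* s ∣
    ≡⟨ cong ℚ.∣_∣ (solve 4 (λ p q r s → p :* q :- r :* s := p :* (q :- s) :+ s :* (p :- r))
                     refl p q r s) ⟩
  ℚ.∣ p ℚ.* (q ℚ.- s) ℚ.+ s ℚ.* (p ℚ.- r) ∣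
    ≤⟨ ℚ.∣p+q∣≤∣p∣+∣q∣ (p ℚ.* (q ℚ.- s)) (s ℚ.* (p ℚ.- r)) ⟩
  ℚ.∣ p ℚ.* (q ℚ.- s) ∣ ℚ.+ ℚ.∣ s ℚ.* (p ℚ.- r) ∣
    ≡⟨ cong₂ ℚ._+_ (ℚ.∣p*q∣≡∣p∣*∣q∣ p (q ℚ.- s)) (ℚ.∣p*q∣≡∣p∣*∣q∣ s (p ℚ.- r)) ⟩
  ℚ.∣ p ∣ ℚ.* ℚ.∣ q ℚ.- s ∣ ℚ.+ ℚ.∣ s ∣ ℚ.* ℚ.∣ p ℚ.- r ∣ ∎
  where
  open +-*-Solver
  open ℚ.≤-Reasoning

∣∣-triangle : ∀ p q → ℚ.∣ p ∣ ℚ.≤ ℚ.∣ p ℚ.- q ∣ ℚ.+ ℚ.∣ q ∣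
∣∣-triangle p q =
  subst (λ t → ℚ.∣ t ∣ ℚ.≤ ℚ.∣ p ℚ.- q ∣ ℚ.+ ℚ.∣ q ∣)
    (solve 2 (λ p q → (p :- q) :+ q := p) refl p q)
    (ℚ.∣p+q∣≤∣p∣+∣q∣ (p ℚ.- q) q)
  where open +-*-Solver

∣-∣-sym : ∀ p q → ℚ.∣ p ℚ.- q ∣ ≡ ℚ.∣ q ℚ.- p ∣
∣-∣-sym p q = trans (sym (ℚ.∣-p∣≡∣p∣ (p ℚ.- q)))
  (cong ℚ.∣_∣ (solve 2 (λ p q → :- (p :- q) := q :- p) refl p q))
  where open +-*-Solver

∣∣-shift : ∀ p q → ℚ.∣ p ∣ ℚ.- ℚ.∣ q ∣ ℚ.≤ ℚ.∣ p ℚ.- q ∣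
∣∣-shift p q = subst (ℚ.∣ p ∣ ℚ.- ℚ.∣ q ∣ ℚ.≤_)
  (solve 2 (λ a b → (a :+ b) :- b := a) refl (ℚ.∣ p ℚ.- q ∣) (ℚ.∣ q ∣))
  (ℚ.+-monoˡ-≤ (ℚ.- ℚ.∣ q ∣) (∣∣-triangle p q))
  where open +-*-Solver

∣∣-contract : ∀ p q → ℚ.∣ ℚ.∣ p ∣ ℚ.- ℚ.∣ q ∣ ∣ ℚ.≤ ℚ.∣ p ℚ.- q ∣
∣∣-contract p q with ℚ.∣p∣≡p∨∣p∣≡-p (ℚ.∣ p ∣ ℚ.- ℚ.∣ q ∣)
... | inj₁ eq = subst (ℚ._≤ ℚ.∣ p ℚ.- q ∣) (sym eq) (∣∣-shift p q)
... | inj₂ eq = subst (ℚ._≤ ℚ.∣ p ℚ.- q ∣) (sym eq)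
  (subst₂ ℚ._≤_
    (solve 2 (λ a b → b :- a := :- (a :- b)) refl (ℚ.∣ p ∣) (ℚ.∣ q ∣))
    (∣-∣-sym q p) (∣∣-shift q p))
  where open +-*-Solver

*-solve : ∀ {p q} → 0ℚ ℚ.< p → 0ℚ ℚ.< q → ∃[ r ] ((0ℚ ℚ.< r) × (q ℚ.* r ≡ p))
*-solve {p} {q} 0<p 0<q = p ℚ.* q⁻¹ , *-pos 0<p 0<q⁻¹ , trans
  (solve 3 (λ p q r → q :* (p :* r) := p :* (q :* r)) refl p q q⁻¹)
  (trans (cong (p ℚ.*_) (ℚ.*-inverseʳ q {{q≢0}})) (ℚ.*-identityʳ p))
  where
  open +-*-Solver
  q≢0   = ℚ.pos⇒nonZero q {{ℚ.positive 0<q}}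
  q⁻¹   = (ℚ.1/ q) {{q≢0}}
  0<q⁻¹ = ℚ.positive⁻¹ q⁻¹ {{ℚ.1/pos⇒pos q {{ℚ.positive 0<q}}}}

scale-< : ∀ {b δ} p q → 0ℚ ℚ.< b → ℚ.∣ p ∣ ℚ.≤ b → ℚ.∣ q ∣ ℚ.< δ →
          ℚ.∣ p ∣ ℚ.* ℚ.∣ q ∣ ℚ.< b ℚ.* δ
scale-< {b} p q 0<b p≤b q<δ = ℚ.≤-<-trans
  (ℚ.*-monoʳ-≤-nonNeg (ℚ.∣ q ∣) {{ℚ.∣-∣-nonNeg q}} p≤b)
  (ℚ.*-monoʳ-<-pos b {{ℚ.positive 0<b}} q<δ)

invℚ : ℚ → ℚ
invℚ q with q ℚ.≟ 0ℚ
... | yes _   = 0ℚ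
... | no  q≢0 = (ℚ.1/ q) {{ℚ.≢-nonZero q≢0}}

*-invℚ : ∀ q → q ≢ 0ℚ → q ℚ.* invℚ q ≡ 1ℚ
*-invℚ q q≢0 with q ℚ.≟ 0ℚ
... | yes q≡0 = contradiction q≡0 q≢0
... | no  q≢0 = ℚ.*-inverseʳ q {{ℚ.≢-nonZero q≢0}}

infixl 6 _-_
infixl 7 _*_ _÷_[_]

fromℚ : ℚ → ℝ
fromℚ q = mkℝ (λ _ → q) λ ε 0<ε →
  0 , λ _ _ _ _ → subst (λ t → ℚ.∣ t ∣ ℚ.< ε) (sym (ℚ.+-inverseʳ q)) 0<ε

0ℝ : ℝ
0ℝ = fromℚ 0ℚ

1ℝ : ℝ
1ℝ = fromℚ 1ℚ

_-_ : ℝ → ℝ → ℝ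
x - y = mkℝ (λ n → seq x n ℚ.- seq y n) λ ε 0<ε →
  let Nx , cx = cauchy x (ε ℚ.* ½) (½-pos 0<ε)
      Ny , cy = cauchy y (ε ℚ.* ½) (½-pos 0<ε)
  in Nx ℕ.⊔ Ny , λ m n N≤m N≤n → ℚ.≤-<-trans
       (-‿triangle (seq x m) (seq y m) (seq x n) (seq y n))
       (subst (_ ℚ.<_) (½+½ ε) (ℚ.+-mono-<
         (cx m n (ℕ.m⊔n≤o⇒m≤o Nx Ny N≤m) (ℕ.m⊔n≤o⇒m≤o Nx Ny N≤n))
         (cy m n (ℕ.m⊔n≤o⇒n≤o Nx Ny N≤m) (ℕ.m⊔n≤o⇒n≤o Nx Ny N≤n))))

∣_∣ : ℝ → ℝ
∣ x ∣ = mkℝ (λ n → ℚ.∣ seq x n ∣) λ ε 0<ε →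
  let N , c = cauchy x ε 0<ε
  in N , λ m n N≤m N≤n →
       ℚ.≤-<-trans (∣∣-contract (seq x m) (seq x n)) (c m n N≤m N≤n)

eventually-bounded : ∀ x → ∃[ B ] ((0ℚ ℚ.< B) × (∃[ N ] (∀ n → N ℕ.≤ n → ℚ.∣ seq x n ∣ ℚ.≤ B)))
eventually-bounded x =
  let N , c = cauchy x 1ℚ (ℚ.positive⁻¹ 1ℚ)
  in 1ℚ ℚ.+ ℚ.∣ seq x N ∣
   , ℚ.+-mono-<-≤ (ℚ.positive⁻¹ 1ℚ) (ℚ.0≤∣p∣ (seq x N))
   , N
   , λ n N≤n → ℚ.≤-trans (∣∣-triangle (seq x n) (seq x N))
                 (ℚ.+-monoˡ-≤ (ℚ.∣ seq x N ∣) (ℚ.<⇒≤ (c n N N≤n ℕ.≤-refl)))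

*-cauchy : ∀ x y ε → 0ℚ ℚ.< ε →
  ∃[ N ] (∀ m n → N ℕ.≤ m → N ℕ.≤ n →
    ℚ.∣ seq x m ℚ.* seq y m ℚ.- seq x n ℚ.* seq y n ∣ ℚ.< ε)
*-cauchy x y ε 0<ε =
  let B , 0<B , K , x≤B  = eventually-bounded x
      C , 0<C , L , y≤C  = eventually-bounded y
      δ , 0<δ , [B+C]δ≡ε = *-solve 0<ε (+-pos 0<B 0<C)
      M , cx             = cauchy x δ 0<δ
      N , cy             = cauchy y δ 0<δ
  in (K ℕ.⊔ L) ℕ.⊔ (M ℕ.⊔ N) , λ m n ≤m ≤n →
  let KL≤m = ℕ.m⊔n≤o⇒m≤o (K ℕ.⊔ L) (M ℕ.⊔ N) ≤m
      KL≤n = ℕ.m⊔n≤o⇒m≤o (K ℕ.⊔ L) (M ℕ.⊔ N) ≤n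
      MN≤m = ℕ.m⊔n≤o⇒n≤o (K ℕ.⊔ L) (M ℕ.⊔ N) ≤m
      MN≤n = ℕ.m⊔n≤o⇒n≤o (K ℕ.⊔ L) (M ℕ.⊔ N) ≤n
  in ℚ.≤-<-trans
       (*-triangle (seq x m) (seq y m) (seq x n) (seq y n))
       (subst (ℚ.∣ seq x m ∣ ℚ.* ℚ.∣ seq y m ℚ.- seq y n ∣ ℚ.+
               ℚ.∣ seq y n ∣ ℚ.* ℚ.∣ seq x m ℚ.- seq x n ∣ ℚ.<_)
         (trans (sym (ℚ.*-distribʳ-+ δ B C)) [B+C]δ≡ε)
         (ℚ.+-mono-<
           (scale-< (seq x m) (seq y m ℚ.- seq y n) 0<B
             (x≤B m (ℕ.m⊔n≤o⇒m≤o K L KL≤m))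
             (cy m n (ℕ.m⊔n≤o⇒n≤o M N MN≤m) (ℕ.m⊔n≤o⇒n≤o M N MN≤n)))
           (scale-< (seq y n) (seq x m ℚ.- seq x n) 0<C
             (y≤C n (ℕ.m⊔n≤o⇒n≤o K L KL≤n))
             (cx m n (ℕ.m⊔n≤o⇒m≤o M N MN≤m) (ℕ.m⊔n≤o⇒m≤o M N MN≤n)))))

_*_ : ℝ → ℝ → ℝ
x * y = mkℝ (λ n → seq x n ℚ.* seq y n) (*-cauchy x y)

apart-from-zero : ∀ x → x # 0ℝ →
  ∃[ δ ] ((0ℚ ℚ.< δ) × (∃[ N ] (∀ n → N ℕ.≤ n → δ ℚ.≤ ℚ.∣ seq x n ∣)))
apart-from-zero x (inj₁ (δ , 0<δ , N , gap)) = δ , 0<δ , N , λ n N≤n →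
  ℚ.≤-trans (δ≤-q (seq x n) (gap n N≤n)) (-q≤∣q∣ (seq x n))
  where
  open +-*-Solver
  δ≤-q : ∀ q → q ℚ.+ δ ℚ.≤ 0ℚ → δ ℚ.≤ ℚ.- q
  δ≤-q q le = subst₂ ℚ._≤_
    (solve 2 (λ q d → :- q :+ (q :+ d) := d) refl q δ)
    (ℚ.+-identityʳ (ℚ.- q)) (ℚ.+-monoʳ-≤ (ℚ.- q) le)
  p≤∣p∣ : ∀ p → p ℚ.≤ ℚ.∣ p ∣
  p≤∣p∣ p with ℚ.≤-total 0ℚ p
  ... | inj₁ 0≤p = ℚ.≤-reflexive (sym (ℚ.0≤p⇒∣p∣≡p 0≤p))
  ... | inj₂ p≤0 = ℚ.≤-trans p≤0 (ℚ.0≤∣p∣ p)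
  -q≤∣q∣ : ∀ q → ℚ.- q ℚ.≤ ℚ.∣ q ∣
  -q≤∣q∣ q = subst (ℚ.- q ℚ.≤_) (ℚ.∣-p∣≡∣p∣ q) (p≤∣p∣ (ℚ.- q))
apart-from-zero x (inj₂ (δ , 0<δ , N , gap)) = δ , 0<δ , N , λ n N≤n →
  let δ≤x = subst (ℚ._≤ seq x n) (ℚ.+-identityˡ δ) (gap n N≤n)
  in ℚ.≤-trans δ≤x (ℚ.≤-reflexive (sym (ℚ.0≤p⇒∣p∣≡p (ℚ.≤-trans (ℚ.<⇒≤ 0<δ) δ≤x))))

∣∣-pos⇒≢0 : ∀ {δ} q → 0ℚ ℚ.< δ → δ ℚ.≤ ℚ.∣ q ∣ → q ≢ 0ℚ
∣∣-pos⇒≢0 q 0<δ δ≤∣q∣ refl = pos⇒≢0 (ℚ.<-≤-trans 0<δ δ≤∣q∣) refl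

invℚ-close : ∀ {δ ε} p q → 0ℚ ℚ.< δ → δ ℚ.≤ ℚ.∣ p ∣ → δ ℚ.≤ ℚ.∣ q ∣ → 0ℚ ℚ.< ε →
  ℚ.∣ p ℚ.- q ∣ ℚ.< ε ℚ.* (δ ℚ.* δ) → ℚ.∣ invℚ p ℚ.- invℚ q ∣ ℚ.< ε
invℚ-close {δ} {ε} p q 0<δ δ≤p δ≤q 0<ε p-q<
  with ℚ.∣ invℚ p ℚ.- invℚ q ∣ ℚ.<? ε
... | yes lt  = lt
... | no  ¬lt = contradiction p-q< (λ lt → ℚ.<-irrefl refl (begin-strict
  ε ℚ.* (δ ℚ.* δ)
    ≤⟨ ℚ.*-monoˡ-≤-nonNeg ε {{ℚ.nonNegative (ℚ.<⇒≤ 0<ε)}} δδ≤pq ⟩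
  ε ℚ.* (ℚ.∣ p ∣ ℚ.* ℚ.∣ q ∣)
    ≡⟨ cong (ε ℚ.*_) (sym (ℚ.∣p*q∣≡∣p∣*∣q∣ p q)) ⟩
  ε ℚ.* ℚ.∣ p ℚ.* q ∣
    ≤⟨ ℚ.*-monoʳ-≤-nonNeg (ℚ.∣ p ℚ.* q ∣) {{ℚ.∣-∣-nonNeg (p ℚ.* q)}} (ℚ.≮⇒≥ ¬lt) ⟩
  ℚ.∣ invℚ p ℚ.- invℚ q ∣ ℚ.* ℚ.∣ p ℚ.* q ∣
    ≡⟨ sym (ℚ.∣p*q∣≡∣p∣*∣q∣ (invℚ p ℚ.- invℚ q) (p ℚ.* q)) ⟩
  ℚ.∣ (invℚ p ℚ.- invℚ q) ℚ.* (p ℚ.* q) ∣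
    ≡⟨ cong ℚ.∣_∣ (trans
         (solve 4 (λ p q r s → (r :- s) :* (p :* q) := (p :* r) :* q :- p :* (q :* s))
            refl p q (invℚ p) (invℚ q))
         (trans (cong₂ (λ s t → s ℚ.* q ℚ.- p ℚ.* t)
                   (*-invℚ p (∣∣-pos⇒≢0 p 0<δ δ≤p)) (*-invℚ q (∣∣-pos⇒≢0 q 0<δ δ≤q)))
                (cong₂ ℚ._-_ (ℚ.*-identityˡ q) (ℚ.*-identityʳ p)))) ⟩
  ℚ.∣ q ℚ.- p ∣
    ≡⟨ ∣-∣-sym q p ⟩
  ℚ.∣ p ℚ.- q ∣
    <⟨ lt ⟩
  ε ℚ.* (δ ℚ.* δ) ∎))
  where
  open +-*-Solver
  open ℚ.≤-Reasoning
  δδ≤pq : δ ℚ.* δ ℚ.≤ ℚ.∣ p ∣ ℚ.* ℚ.∣ q ∣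
  δδ≤pq = ℚ.≤-trans
    (ℚ.*-monoˡ-≤-nonNeg δ {{ℚ.nonNegative (ℚ.<⇒≤ 0<δ)}} δ≤q)
    (ℚ.*-monoʳ-≤-nonNeg (ℚ.∣ q ∣) {{ℚ.∣-∣-nonNeg q}} δ≤p)

-- Only finitely many terms of x can vanish; invℚ sends those to 0, which
-- does not affect the real number represented.

inv : (x : ℝ) → x # 0ℝ → ℝ
inv x x#0 = mkℝ (λ n → invℚ (seq x n)) λ ε 0<ε →
  let δ , 0<δ , N , δ≤x = apart-from-zero x x#0
      M , c = cauchy x (ε ℚ.* (δ ℚ.* δ)) (*-pos 0<ε (*-pos 0<δ 0<δ))
  in N ℕ.⊔ M , λ m n N≤m N≤n → invℚ-close (seq x m) (seq x n) 0<δ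
       (δ≤x m (ℕ.m⊔n≤o⇒m≤o N M N≤m)) (δ≤x n (ℕ.m⊔n≤o⇒m≤o N M N≤n)) 0<ε
       (c m n (ℕ.m⊔n≤o⇒n≤o N M N≤m) (ℕ.m⊔n≤o⇒n≤o N M N≤n))

_÷_[_] : (x y : ℝ) → y # 0ℝ → ℝ
x ÷ y [ y#0 ] = x * inv y y#0

*-inverseʳ : ∀ x (x#0 : x # 0ℝ) → x * inv x x#0 ≈ 1ℝ
*-inverseʳ x x#0 ε 0<ε =
  let δ , 0<δ , N , δ≤x = apart-from-zero x x#0
  in N , λ n N≤n → subst (λ t → ℚ.∣ t ℚ.- 1ℚ ∣ ℚ.< ε)
       (sym (*-invℚ (seq x n) (∣∣-pos⇒≢0 (seq x n) 0<δ (δ≤x n N≤n)))) 0<ε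

infix 4 _⟶_

_⟶_ : (ℕ → ℝ) → ℝ → Set
u ⟶ L = ∀ ε → 0ℝ < ε → ∃[ N ] (∀ n → N ℕ.≤ n → ∣ u n - L ∣ < ε)

EventuallyNonZero : (ℕ → ℝ) → Set
EventuallyNonZero g = ∃[ n₀ ] (∀ n → n₀ ℕ.≤ n → g n # 0ℝ)

-- f(n)/g(n) exists only from some index n₀ on, so the quotient sequence
-- is k ↦ f(n₀ + k)/g(n₀ + k); the omitted initial part does not affect
-- the limit.

quotient : (f g : ℕ → ℝ) → EventuallyNonZero g → ℕ → ℝ
quotient f g (n₀ , g#0) k =
  f (n₀ ℕ.+ k) ÷ g (n₀ ℕ.+ k) [ g#0 (n₀ ℕ.+ k) (ℕ.m≤m+n n₀ k) ]

a : ℝ → (g : ℕ → ℝ) → EventuallyNonZero g → Pred (ℕ → ℝ) 0ℓ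
a K g g#0 f = quotient f g g#0 ⟶ K

O : (ℕ → ℝ) → Pred (ℕ → ℝ) 0ℓ
O g f = ∃[ k ] ((0ℝ < k) × (∃[ n₀ ] (∀ n → n₀ ℕ.< n → ∣ f n ∣ ≤ ∣ g n * k ∣)))

{-# OPTIONS --safe #-}
-- If f/g → K then eventually ∣f/g - K∣ < 1, so ∣f∣ ≤ (B + 1) ∣g∣ for any rational
-- B ≥ ∣K∣. The converse fails for f = 0 and g = 1: the quotient is 0, whose
-- distance to K > 0 is never below K.

module Submission where

open import Data.Nat.Base as ℕ using (ℕ)
import Data.Nat.Properties as ℕ
open import Data.Product.Base using (_×_; _,_; Σ-syntax)
open import Data.Rational.Base as ℚ using (0ℚ; 1ℚ)
import Data.Rational.Properties as ℚ
open import Data.Rational.Solver using (module +-*-Solver)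
open import Data.Sum.Base using (inj₁; inj₂)
open import Relation.Binary.PropositionalEquality
  using (_≡_; _≢_; refl; sym; trans; cong; subst)
open import Relation.Nullary.Negation.Core using (¬_)
open import Relation.Unary using (_∈_; _∉_)
open import Defs

-- Convergence used at the single tolerance 1 puts the quotient eventually within 1 of `K`, so the
-- rational constant `1ℚ ℚ.+ B` bounds its modulus; multiplying by the modulus of `g` gives the
-- Big-Oh bound. As `_≤_` on reals is a negated `_<_`, it suffices to refute a uniform gap at one
-- index of the Cauchy sequences, a computation in the rationals: this is `quotient-close⇒≤`, which
-- `a⇒O` applies along the sequence. The converse is refuted by the constants 0 and 1.

p≤∣p∣ : ∀ p → p ℚ.≤ ℚ.∣ p ∣
p≤∣p∣ p with ℚ.≤-total 0ℚ p
... | inj₁ 0≤p = ℚ.≤-reflexive (sym (ℚ.0≤p⇒∣p∣≡p 0≤p))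
... | inj₂ p≤0 = ℚ.≤-trans p≤0 (ℚ.0≤∣p∣ p)

p<p+q : ∀ p {q} → 0ℚ ℚ.< q → p ℚ.< p ℚ.+ q
p<p+q p {q} 0<q = subst (ℚ._< p ℚ.+ q) (ℚ.+-identityʳ p) (ℚ.+-monoʳ-< p 0<q)

p+q≰p : ∀ p {q} → 0ℚ ℚ.< q → ¬ (p ℚ.+ q ℚ.≤ p)
p+q≰p p 0<q le = ℚ.<-irrefl refl (ℚ.<-≤-trans (p<p+q p 0<q) le)

p≡q*[p*invℚq] : ∀ p q → q ≢ 0ℚ → p ≡ q ℚ.* (p ℚ.* invℚ q)
p≡q*[p*invℚq] p q q≢0 = sym (trans
  (solve 3 (λ p q r → q :* (p :* r) := p :* (q :* r)) refl p q (invℚ q))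
  (trans (cong (p ℚ.*_) (*-invℚ q q≢0)) (ℚ.*-identityʳ p)))
  where open +-*-Solver

∣p∣≤∣q*c∣ : ∀ p q {c} → 0ℚ ℚ.< c → q ≢ 0ℚ → ℚ.∣ p ℚ.* invℚ q ∣ ℚ.≤ c →
            ℚ.∣ p ∣ ℚ.≤ ℚ.∣ q ℚ.* c ∣
∣p∣≤∣q*c∣ p q {c} 0<c q≢0 p/q≤c = begin
  ℚ.∣ p ∣
    ≡⟨ cong ℚ.∣_∣ (p≡q*[p*invℚq] p q q≢0) ⟩
  ℚ.∣ q ℚ.* (p ℚ.* invℚ q) ∣
    ≡⟨ ℚ.∣p*q∣≡∣p∣*∣q∣ q (p ℚ.* invℚ q) ⟩
  ℚ.∣ q ∣ ℚ.* ℚ.∣ p ℚ.* invℚ q ∣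
    ≤⟨ ℚ.*-monoˡ-≤-nonNeg (ℚ.∣ q ∣) {{ℚ.∣-∣-nonNeg q}} p/q≤c ⟩
  ℚ.∣ q ∣ ℚ.* c
    ≡⟨ cong (ℚ.∣ q ∣ ℚ.*_) (sym (ℚ.0≤p⇒∣p∣≡p (ℚ.<⇒≤ 0<c))) ⟩
  ℚ.∣ q ∣ ℚ.* ℚ.∣ c ∣
    ≡⟨ sym (ℚ.∣p*q∣≡∣p∣*∣q∣ q c) ⟩
  ℚ.∣ q ℚ.* c ∣ ∎
  where open ℚ.≤-Reasoning

0<q⇒0ℝ<fromℚ : ∀ {q} → 0ℚ ℚ.< q → 0ℝ < fromℚ q
0<q⇒0ℝ<fromℚ {q} 0<q = q , 0<q , 0 , λ _ _ → ℚ.≤-reflexive (ℚ.+-identityˡ q)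

0ℝ<1ℝ : 0ℝ < 1ℝ
0ℝ<1ℝ = 0<q⇒0ℝ<fromℚ (ℚ.positive⁻¹ 1ℚ)

-- The triangle inequality bounds the quotient by `1ℚ ℚ.+ B`, and `∣p∣≤∣q*c∣` clears the
-- denominator; the opposite strict inequality would leave a gap `η` that this excludes.
quotient-close⇒≤ : ∀ x y (y#0 : y # 0ℝ) z {B M} → 0ℚ ℚ.< B →
  (∀ n → M ℕ.≤ n → ℚ.∣ seq z n ∣ ℚ.≤ B) →
  ∣ x ÷ y [ y#0 ] - z ∣ < 1ℝ → ∣ x ∣ ≤ ∣ y * fromℚ (1ℚ ℚ.+ B) ∣
quotient-close⇒≤ x y y#0 z {B} {M} 0<B z≤B
  (δ , 0<δ , N , close) (η , 0<η , L , gap) =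
  let γ , 0<γ , P , γ≤y = apart-from-zero y y#0
      -- Past `M` the bound on `z` holds, past `N` the closeness, past `L` the supposed gap, past
      -- `P` the separation of `y` from zero.
      n   = (M ℕ.⊔ N) ℕ.⊔ (L ℕ.⊔ P)
      MN≤ = ℕ.m≤m⊔n (M ℕ.⊔ N) (L ℕ.⊔ P)
      LP≤ = ℕ.m≤n⊔m (M ℕ.⊔ N) (L ℕ.⊔ P)
      q   = seq x n ℚ.* invℚ (seq y n)
      q-z≤1 = ℚ.≤-trans (ℚ.<⇒≤ (p<p+q (ℚ.∣ q ℚ.- seq z n ∣) 0<δ))
                (close n (ℕ.m⊔n≤o⇒n≤o M N MN≤))
      q≤1+B = ℚ.≤-trans (∣∣-triangle q (seq z n))
                (ℚ.+-mono-≤ q-z≤1 (z≤B n (ℕ.m⊔n≤o⇒m≤o M N MN≤)))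
      -- This makes `invℚ` the true reciprocal here, not its default value 0.
      y≢0 = ∣∣-pos⇒≢0 (seq y n) 0<γ (γ≤y n (ℕ.m⊔n≤o⇒n≤o L P LP≤))
  in p+q≰p (ℚ.∣ seq y n ℚ.* (1ℚ ℚ.+ B) ∣) 0<η
       (ℚ.≤-trans (gap n (ℕ.m⊔n≤o⇒m≤o L P LP≤))
         (∣p∣≤∣q*c∣ (seq x n) (seq y n) (+-pos (ℚ.positive⁻¹ 1ℚ) 0<B) y≢0 q≤1+B))

a⇒O : (f g : ℕ → ℝ) (g#0 : EventuallyNonZero g) (K : ℝ) → f ∈ a K g g#0 → f ∈ O g
a⇒O f g (n₀ , g#0) K f/g⟶K =
  let B , 0<B , _ , K≤B = eventually-bounded K
      N , close         = f/g⟶K 1ℝ 0ℝ<1ℝ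
      k                 = fromℚ (1ℚ ℚ.+ B)
  in k , 0<q⇒0ℝ<fromℚ (+-pos (ℚ.positive⁻¹ 1ℚ) 0<B) , n₀ ℕ.+ N , λ n n₀+N<n →
  let n₀+N≤n = ℕ.<⇒≤ n₀+N<n
      n₀≤n   = ℕ.m+n≤o⇒m≤o n₀ n₀+N≤n
      -- The quotient sequence starts at `n₀`, so its term for `n` has index `i`; the truncated
      -- subtraction is exact because `n₀≤n`.
      i      = n ℕ.∸ n₀
      N≤i    = ℕ.m+n≤o⇒m≤o∸n N (subst (ℕ._≤ n) (ℕ.+-comm n₀ N) n₀+N≤n)
  in subst (λ m → ∣ f m ∣ ≤ ∣ g m * k ∣) (ℕ.m+[n∸m]≡n n₀≤n)
       (quotient-close⇒≤ (f (n₀ ℕ.+ i)) (g (n₀ ℕ.+ i))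
         (g#0 (n₀ ℕ.+ i) (ℕ.m≤m+n n₀ i)) K 0<B K≤B (close i N≤i))

1#0 : EventuallyNonZero (λ _ → 1ℝ)
1#0 = 0 , λ _ _ → inj₂ 0ℝ<1ℝ

0∈O[1] : (λ _ → 0ℝ) ∈ O (λ _ → 1ℝ)
0∈O[1] = 1ℝ , 0ℝ<1ℝ , 0 , λ _ _ (δ , 0<δ , N , gap) →
  p+q≰p 1ℚ 0<δ (ℚ.≤-trans (gap N ℕ.≤-refl) (ℚ.<⇒≤ (ℚ.positive⁻¹ 1ℚ)))

-- The tolerance is `K` itself, admissible since `K` is positive. At the index `M`, closeness says
-- that the modulus of `0ℚ ℚ.- p` plus `δ` is at most `p`, yet `p` never exceeds that modulus.
0∉a[K,1] : (K : ℝ) → 0ℝ < K → (λ _ → 0ℝ) ∉ a K (λ _ → 1ℝ) 1#0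
0∉a[K,1] K 0<K 0⟶K =
  let N , close         = 0⟶K K 0<K
      δ , 0<δ , M , gap = close N ℕ.≤-refl
      p                 = seq K M
      ∣p∣≡∣0-p∣         = trans (sym (ℚ.∣-p∣≡∣p∣ p))
                            (cong ℚ.∣_∣ (sym (ℚ.+-identityˡ (ℚ.- p))))
      K≤∣0-K∣           = subst (p ℚ.≤_) ∣p∣≡∣0-p∣ (p≤∣p∣ p)
  in p+q≰p (ℚ.∣ 0ℚ ℚ.- p ∣) 0<δ (ℚ.≤-trans (gap M ℕ.≤-refl) K≤∣0-K∣)

theorem3p2 : ((f g : ℕ → ℝ) (g#0 : EventuallyNonZero g) (K : ℝ) → 0ℝ < K →
    f ∈ a K g g#0 → f ∈ O g)
    × (Σ[ f ∈ (ℕ → ℝ) ] Σ[ g ∈ (ℕ → ℝ) ] Σ[ g#0 ∈ EventuallyNonZero g ]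
    ((f ∈ O g) × ((K : ℝ) → 0ℝ < K → f ∉ a K g g#0)))
theorem3p2 =
  (λ f g g#0 K _ → a⇒O f g g#0 K) ,
  (λ _ → 0ℝ) , (λ _ → 1ℝ) , 1#0 , 0∈O[1] , 0∉a[K,1]
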